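{- For every integer $t\geq 2$, if $G$ is a triangle-free $K_{2,t}$-free graph with diameter $2$ and $G$ is not a star graph, then $$\Delta(G)\leq (t-1)\big( (t-1)\delta(G)-t+2\big)-t+2.$$
   Context: All graphs are finite, simple and undirected. A graph is $H$-free if it contains no (not necessarily induced) subgraph isomorphic to $H$; triangle-free means $K_3$-free. A graph has diameter $2$ if it is connected and the maximum distance between two of its vertices is exactly $2$. A star graph is a graph isomorphic to $K_{1,m}$ for some $m\geq 1$. $\delta(G)$ and $\Delta(G)$ denote the minimum and maximum degree of $G$, respectively. -}

module Defs where

open import Data.Empty using (⊥)
open import Data.Fin.Base using (Fin)
import Data.Fin.Properties as Fin
open import Data.List.Base using (List; allFin; filter; length; map)
open import Data.List.Extrema.Nat using (max; min)
open import Data.Nat.Base using (ℕ; zero; suc; _≤_; _≥_)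
open import Data.Product.Base using (Σ-syntax; ∃-syntax; _×_)
open import Data.Sum.Base using (_⊎_; inj₁; inj₂)
open import Data.Unit.Base using (⊤; tt)
open import Function.Bundles using (_↣_; _↔_; _⇔_; Injection; Inverse)
open import Relation.Binary.Core using (Rel)
open import Relation.Binary.Definitions using (Decidable; Irreflexive; Symmetric)
open import Relation.Binary.PropositionalEquality.Core using (_≡_; _≢_; ≢-sym)
open import Relation.Nullary.Decidable.Core using (yes; no; ¬?)
open import Relation.Nullary.Negation.Core using (¬_)
open import Level using (0ℓ)

-- Simple undirected graphs on V; a finite graph is a Graph (Fin n).
-- Decidability of adjacency is automatic classically; here it is what makes
-- degrees computable.
record Graph (V : Set) : Set₁ where
  infix 4 _~_ _~?_
  field
    _~_    : Rel V 0ℓ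
    _~?_   : Decidable _~_
    irrefl : Irreflexive _≡_ _~_
    sym    : Symmetric _~_

open Graph public using () renaming (_~_ to Adj)

K : (r : ℕ) → Graph (Fin r)
K r = record
  { _~_    = _≢_
  ; _~?_   = λ i j → ¬? (i Fin.≟ j)
  ; irrefl = λ i≡j i≢j → i≢j i≡j
  ; sym    = ≢-sym
  }

AcrossParts : (a b : ℕ) → Rel (Fin a ⊎ Fin b) 0ℓ
AcrossParts a b (inj₁ _) (inj₁ _) = ⊥
AcrossParts a b (inj₁ _) (inj₂ _) = ⊤
AcrossParts a b (inj₂ _) (inj₁ _) = ⊤
AcrossParts a b (inj₂ _) (inj₂ _) = ⊥

CompleteBipartite : (a b : ℕ) → Graph (Fin a ⊎ Fin b)
CompleteBipartite a b = record
  { _~_    = AcrossParts a b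
  ; _~?_   = across?
  ; irrefl = λ {i} {j} → irr i j
  ; sym    = λ {i} {j} → sy i j
  }
  where
  across? : Decidable (AcrossParts a b)
  across? (inj₁ _) (inj₁ _) = no λ ()
  across? (inj₁ _) (inj₂ _) = yes tt
  across? (inj₂ _) (inj₁ _) = yes tt
  across? (inj₂ _) (inj₂ _) = no λ ()

  irr : ∀ i j → i ≡ j → ¬ AcrossParts a b i j
  irr (inj₁ _) (inj₁ _) _ ()
  irr (inj₂ _) (inj₂ _) _ ()
  irr (inj₁ _) (inj₂ _) ()
  irr (inj₂ _) (inj₁ _) ()

  sy : ∀ i j → AcrossParts a b i j → AcrossParts a b j i
  sy (inj₁ _) (inj₂ _) _ = tt
  sy (inj₂ _) (inj₁ _) _ = tt

infix 4 _⊑_ _≅_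

-- H is isomorphic to a (not necessarily induced) subgraph of G, so edges
-- need only be preserved, not reflected.
_⊑_ : {V W : Set} → Graph V → Graph W → Set
_⊑_ {V} {W} H G =
  Σ[ f ∈ V ↣ W ] (∀ u v → Adj H u v → Adj G (Injection.to f u) (Injection.to f v))

_≅_ : {V W : Set} → Graph V → Graph W → Set
_≅_ {V} {W} G H =
  Σ[ f ∈ V ↔ W ] (∀ u v → Adj G u v ⇔ Adj H (Inverse.to f u) (Inverse.to f v))

_-Free : {V W : Set} → Graph V → Graph W → Set
(H -Free) G = ¬ (H ⊑ G)

TriangleFree : {V : Set} → Graph V → Set
TriangleFree = K 3 -Free

IsStar : {V : Set} → Graph V → Set
IsStar G = ∃[ m ] (m ≥ 1 × G ≅ CompleteBipartite 1 m)

data Walk {V : Set} (G : Graph V) : ℕ → V → V → Set where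
  []  : ∀ {u} → Walk G zero u u
  _∷_ : ∀ {k u v w} → Adj G u v → Walk G k v w → Walk G (suc k) u w

Connected : {V : Set} → Graph V → Set
Connected G = ∀ u v → ∃[ k ] Walk G k u v

Distance : {V : Set} → Graph V → V → V → ℕ → Set
Distance G u v d = Walk G d u v × (∀ k → Walk G k u v → d ≤ k)

HasDiameter : {V : Set} → Graph V → ℕ → Set
HasDiameter G d =
  Connected G
  × (∀ u v k → Distance G u v k → k ≤ d)
  × ∃[ u ] ∃[ v ] Distance G u v d

neighbours : {n : ℕ} → Graph (Fin n) → Fin n → List (Fin n)
neighbours {n} G v = filter (Graph._~?_ G v) (allFin n)

degree : {n : ℕ} → Graph (Fin n) → Fin n → ℕ
degree G v = length (neighbours G v)

degrees : {n : ℕ} → Graph (Fin n) → List ℕ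
degrees {n} G = map (degree G) (allFin n)

-- The first arguments of min and max are also compared with the list. Every
-- degree is at least 0 and at most n, so they have no effect when n ≥ 1.
δ : {n : ℕ} → Graph (Fin n) → ℕ
δ {n} G = min n (degrees G)

Δ : {n : ℕ} → Graph (Fin n) → ℕ
Δ G = max 0 (degrees G)

{-# OPTIONS --safe #-}
-- Put s = t − 1, so that distinct vertices have at most s common neighbours;
-- the claim is Δ − 1 ≤ s²(δ − 1).
--
-- If v and w are not adjacent, fix a common neighbour c. Every neighbour of w
-- other than c equals or is adjacent to a neighbour of v other than c, and each
-- of the latter serves at most s of the former, so
-- deg w − 1 ≤ s (deg v − 1).
--
-- If v and w are adjacent, v has a neighbour a ≠ w, as otherwise G is a star
-- with centre w. If N(w) ⊆ N(a), then deg w ≤ s. Otherwise take b in N(w) not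
-- adjacent to a: a common neighbour of a and b is adjacent to neither v nor w,
-- and the first case applies twice.
module Submission where

open import Defs
open import Data.Empty using (⊥; ⊥-elim)
open import Data.Fin.Base using (Fin; zero; suc; punchIn; punchOut; inject≤)
open import Data.Fin.Properties
  using (_≟_; any?; inject≤-injective; punchInᵢ≢i; punchIn-punchOut; punchOut-punchIn; punchOut-cong)
open import Data.Integer.Base using (+_; _+_; _-_; _*_; _≤_; +≤+)
import Data.Integer.Properties as ℤ
open import Data.Integer.Tactic.RingSolver using (solve-∀)
open import Data.List.Base using (List; []; _∷_; length; filter; lookup; allFin)
open import Data.List.Extrema.Nat using (argmin-sel; max≤v⁺; min≤xs)
open import Data.List.Membership.Propositional using (_∈_)
open import Data.List.Membership.Propositional.Properties
  using (∈-filter⁺; ∈-filter⁻; ∈-allFin; ∈-lookup; ∈-length; ∈-map⁺; ∈-map⁻)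
open import Data.List.Properties using (filter-notAll; filter-some; length-filter; length-tabulate)
open import Data.List.Relation.Unary.All as All using (All; []; _∷_)
import Data.List.Relation.Unary.All.Properties as All
open import Data.List.Relation.Unary.AllPairs using ([]; _∷_)
open import Data.List.Relation.Unary.Any as Any using (here; there)
open import Data.List.Relation.Unary.Unique.Propositional using (Unique)
open import Data.List.Relation.Unary.Unique.Propositional.Properties using (allFin⁺)
  renaming (filter⁺ to Unique-filter⁺)
open import Data.Nat.Base as ℕ using (ℕ; zero; suc; pred; z≤n; s≤s; _≥_)
open import Data.Nat.Induction using (<-rec)
import Data.Nat.Properties as ℕ
open import Data.Product.Base using (∃-syntax; _×_; _,_; proj₁; proj₂)
open import Data.Sum.Base using (_⊎_; inj₁; inj₂)
open import Function.Base using (_∘_; id)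
open import Function.Bundles using (_⇔_; mk↣; mk⇔; mk↔ₛ′)
open import Level using (0ℓ)
open import Relation.Binary.Core using (REL)
import Relation.Binary.Definitions as B
open import Relation.Binary.PropositionalEquality
  using (_≡_; _≢_; refl; sym; trans; cong; subst; ≢-sym)
open import Relation.Nullary.Decidable using (yes; no; ¬?; _×-dec_; _⊎-dec_)
open import Relation.Nullary.Negation.Core using (¬_; contradiction)
open import Relation.Unary using (Pred; Decidable)

private
  variable
    A C : Set
    n s : ℕ

-- Counting in duplicate-free lists

length-filter-∁ : {P : Pred A 0ℓ} (P? : Decidable P) (xs : List A) →
  length (filter P? xs) ℕ.+ length (filter (¬? ∘ P?) xs) ≡ length xs
length-filter-∁ P? [] = refl
length-filter-∁ P? (x ∷ xs) with P? x
... | yes _ = cong suc (length-filter-∁ P? xs)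
... | no  _ = trans (ℕ.+-suc _ _) (cong suc (length-filter-∁ P? xs))

-- Double counting by induction on `ys`: the entries related to the head `y` number at most `s`, and
-- the others are covered by the tail. The fibre bound ranges over every duplicate-free list with
-- property `P`, so it survives the shrinking of `xs`.
length-cover : {P : Pred A 0ℓ} {R : REL A C 0ℓ} → B.Decidable R →
  {xs : List A} (ys : List C) → Unique xs → All P xs →
  (∀ {x} → x ∈ xs → ∃[ y ] (y ∈ ys × R x y)) →
  (∀ {y} → y ∈ ys → ∀ {zs} → Unique zs → All (λ x → P x × R x y) zs → length zs ℕ.≤ s) →
  length xs ℕ.≤ s ℕ.* length ys
length-cover R? {[]} [] _ _ _ _ = z≤n
length-cover R? {x ∷ xs} [] _ _ cover _ with cover (here refl)
... | _ , () , _
length-cover {s = s} R? {xs} (y ∷ ys) uniq all cover fibre = begin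
  length xs                                              ≡⟨ length-filter-∁ Ry? xs ⟨
  length (filter Ry? xs) ℕ.+ length (filter (¬? ∘ Ry?) xs) ≤⟨ ℕ.+-mono-≤ over-y over-ys ⟩
  s ℕ.+ s ℕ.* length ys                                  ≡⟨ ℕ.*-suc s (length ys) ⟨
  s ℕ.* suc (length ys)                                  ∎
  where
  open ℕ.≤-Reasoning
  Ry? = λ x → R? x y
  over-y = fibre (here refl) (Unique-filter⁺ Ry? uniq)
    (All.zip (All.filter⁺ Ry? all , All.all-filter Ry? xs))
  cover′ : ∀ {x} → x ∈ filter (¬? ∘ Ry?) xs → ∃[ z ] (z ∈ ys × _)
  cover′ x∈ with x∈xs , ¬xRy ← ∈-filter⁻ (¬? ∘ Ry?) x∈ with cover x∈xs
  ... | _ , here refl , xRy = contradiction xRy ¬xRy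
  ... | z , there z∈  , xRz = z , z∈ , xRz
  over-ys = length-cover R? ys (Unique-filter⁺ (¬? ∘ Ry?) uniq)
    (All.filter⁺ (¬? ∘ Ry?) all) cover′ (fibre ∘ there)

all≡⇒length≤1 : {y : A} {xs : List A} → Unique xs → All (_≡ y) xs → length xs ℕ.≤ 1
all≡⇒length≤1 [] [] = z≤n
all≡⇒length≤1 (_ ∷ []) (_ ∷ []) = s≤s z≤n
all≡⇒length≤1 ((x≢x ∷ _) ∷ _) (refl ∷ refl ∷ _) = contradiction refl x≢x

lookup-injective : {xs : List A} → Unique xs → ∀ {i j} → lookup xs i ≡ lookup xs j → i ≡ j
lookup-injective (_   ∷ _)  {zero}  {zero}  _  = refl
lookup-injective (x≢ ∷ _)  {zero}  {suc j} eq = contradiction eq (All.lookup x≢ (∈-lookup j))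
lookup-injective (x≢ ∷ _)  {suc i} {zero}  eq = contradiction (sym eq) (All.lookup x≢ (∈-lookup i))
lookup-injective (_   ∷ uq) {suc i} {suc j} eq = cong suc (lookup-injective uq eq)

without : Fin n → List (Fin n) → List (Fin n)
without c = filter (λ x → ¬? (x ≟ c))

length-without≤ : {c : Fin n} {xs : List (Fin n)} → c ∈ xs →
  length (without c xs) ℕ.≤ pred (length xs)
length-without≤ c∈xs =
  ℕ.<⇒≤pred (filter-notAll _ _ (Any.map (λ c≡x x≢c → x≢c (sym c≡x)) c∈xs))

-- A duplicate-free list contains `c` at most once, so filtering it out costs at most one entry.
pred-length≤without : (c : Fin n) {xs : List (Fin n)} → Unique xs →
  pred (length xs) ℕ.≤ length (without c xs)
pred-length≤without c {xs} uniq = ℕ.pred-mono-≤ (begin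
  length xs                                         ≡⟨ length-filter-∁ (_≟ c) xs ⟨
  length (filter (_≟ c) xs) ℕ.+ length (without c xs) ≤⟨ ℕ.+-monoˡ-≤ _ removed ⟩
  suc (length (without c xs))                       ∎)
  where
  open ℕ.≤-Reasoning
  removed = all≡⇒length≤1 (Unique-filter⁺ (_≟ c) uniq) (All.all-filter (_≟ c) xs)

-- Neighbourhoods and forbidden subgraphs

module _ {n : ℕ} (G : Graph (Fin n)) where

  open Graph G using (_~_; _~?_; irrefl) renaming (sym to ~-sym)

  ∈-neighbours⁺ : ∀ {v x} → v ~ x → x ∈ neighbours G v
  ∈-neighbours⁺ {v} {x} = ∈-filter⁺ (v ~?_) (∈-allFin x)

  ∈-neighbours⁻ : ∀ {v x} → x ∈ neighbours G v → v ~ x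
  ∈-neighbours⁻ {v} = proj₂ ∘ ∈-filter⁻ (v ~?_) {xs = allFin n}

  neighbours-unique : ∀ v → Unique (neighbours G v)
  neighbours-unique v = Unique-filter⁺ (v ~?_) (allFin⁺ n)

  ~⇒≢ : ∀ {u v} → u ~ v → u ≢ v
  ~⇒≢ u~v u≡v = irrefl u≡v u~v

  no-triangle : TriangleFree G → ∀ {x y z} → x ~ y → y ~ z → x ~ z → ⊥
  no-triangle free {x} {y} {z} xy yz xz = free (mk↣ injective , edges)
    where
    f : Fin 3 → Fin n
    f zero             = x
    f (suc zero)       = y
    f (suc (suc zero)) = z
    edges : ∀ i j → i ≢ j → f i ~ f j
    edges zero zero i≢j = contradiction refl i≢j
    edges zero (suc zero) _ = xy
    edges zero (suc (suc zero)) _ = xz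
    edges (suc zero) zero _ = ~-sym xy
    edges (suc zero) (suc zero) i≢j = contradiction refl i≢j
    edges (suc zero) (suc (suc zero)) _ = yz
    edges (suc (suc zero)) zero _ = ~-sym xz
    edges (suc (suc zero)) (suc zero) _ = ~-sym yz
    edges (suc (suc zero)) (suc (suc zero)) i≢j = contradiction refl i≢j
    injective : ∀ {i j} → f i ≡ f j → i ≡ j
    injective {i} {j} fi≡fj with i ≟ j
    ... | yes i≡j = i≡j
    ... | no  i≢j = contradiction fi≡fj (~⇒≢ (edges i j i≢j))

  -- If `xs` had more than `s` entries, its first `suc s` would form the large part of a forbidden
  -- subgraph, with `u` and `v` as the small part.
  common-neighbours≤ : (CompleteBipartite 2 (suc s) -Free) G → ∀ {u v} → u ≢ v →
    ∀ {xs} → Unique xs → All (λ x → u ~ x × v ~ x) xs → length xs ℕ.≤ s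
  common-neighbours≤ {s} free {u} {v} u≢v {xs} uniq all =
    ℕ.≮⇒≥ λ s<len → free (mk↣ (injective s<len) , edges s<len)
    where
    module _ (s<len : s ℕ.< length xs) where
      side : Fin 2 → Fin n
      side zero       = u
      side (suc zero) = v
      f : Fin 2 ⊎ Fin (suc s) → Fin n
      f (inj₁ i) = side i
      f (inj₂ j) = lookup xs (inject≤ j s<len)
      across : ∀ i j → f (inj₁ i) ~ f (inj₂ j)
      across zero       j = proj₁ (All.lookup all (∈-lookup (inject≤ j s<len)))
      across (suc zero) j = proj₂ (All.lookup all (∈-lookup (inject≤ j s<len)))
      edges : ∀ p q → AcrossParts 2 (suc s) p q → f p ~ f q
      edges (inj₁ i) (inj₂ j) _ = across i j
      edges (inj₂ j) (inj₁ i) _ = ~-sym (across i j)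
      side-injective : ∀ i j → side i ≡ side j → i ≡ j
      side-injective zero       zero       _  = refl
      side-injective zero       (suc zero) eq = contradiction eq u≢v
      side-injective (suc zero) zero       eq = contradiction (sym eq) u≢v
      side-injective (suc zero) (suc zero) _  = refl
      injective : ∀ {p q} → f p ≡ f q → p ≡ q
      injective {inj₁ i} {inj₁ j} eq = cong inj₁ (side-injective i j eq)
      -- Vertices from opposite parts have adjacent images, hence distinct ones.
      injective {inj₁ i} {inj₂ j} eq = contradiction eq (~⇒≢ (across i j))
      injective {inj₂ j} {inj₁ i} eq = contradiction (sym eq) (~⇒≢ (across i j))
      injective {inj₂ i} {inj₂ j} eq =
        cong inj₂ (inject≤-injective s<len s<len i j (lookup-injective uniq eq))

  -- Consequences of diameter 2

  common-neighbour : HasDiameter G 2 → ∀ {u v} → u ≢ v → ¬ u ~ v → ∃[ c ] (u ~ c × v ~ c)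
  common-neighbour (connected , bounded , _) {u} {v} u≢v u≁v
    with any? (λ c → (u ~? c) ×-dec (v ~? c))
  ... | yes found = found
  ... | no  none  = contradiction (proj₂ (connected u v)) (no-walk (proj₁ (connected u v)))
    where
    not-short : ∀ {k} → k ℕ.≤ 2 → ¬ Walk G k u v
    not-short _ []              = u≢v refl
    not-short _ (e ∷ [])        = u≁v e
    not-short _ (e ∷ e′ ∷ [])   = none (_ , e , ~-sym e′)
    not-short (s≤s (s≤s ())) (_ ∷ _ ∷ _ ∷ _)
    -- Strong induction stands in for choosing a shortest walk: if no shorter walk exists, `k` is
    -- the distance, so `k ≤ 2`, and `not-short` excludes lengths 0, 1 and 2.
    no-walk : ∀ k → ¬ Walk G k u v
    no-walk = <-rec (λ k → ¬ Walk G k u v) λ k shorter walk →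
      not-short (bounded u v k (walk , λ j walk′ → ℕ.≮⇒≥ λ j<k → shorter j<k walk′)) walk

  -- A nonempty walk from `v` starts with an edge. If the walks to `a` and `b` were both empty,
  -- these two vertices at distance 2 would coincide.
  has-neighbour : HasDiameter G 2 → ∀ v → ∃[ x ] v ~ x
  has-neighbour (connected , _ , a , b , _ , shortest) v
    with connected v a | connected v b
  ... | _ , e ∷ _ | _          = _ , e
  ... | _ , []    | _ , e ∷ _  = _ , e
  ... | _ , []    | _ , []     = contradiction (shortest 0 []) λ ()

  -- Degrees of nonadjacent vertices

  pred-degree-nonadjacent : TriangleFree G → (CompleteBipartite 2 (suc s) -Free) G →
    HasDiameter G 2 → s ≥ 1 → ∀ {v w} → v ≢ w → ¬ v ~ w →
    pred (degree G w) ℕ.≤ s ℕ.* pred (degree G v)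
  pred-degree-nonadjacent {s} tri free diam s≥1 {v} {w} v≢w v≁w
    with c , v~c , w~c ← common-neighbour diam v≢w v≁w = begin
    pred (degree G w)                       ≤⟨ pred-length≤without c (neighbours-unique w) ⟩
    length (without c (neighbours G w))     ≤⟨ length-cover R? _
                                                 (Unique-filter⁺ _ (neighbours-unique w))
                                                 (All.tabulate (∈-neighbours⁻ ∘ proj₁ ∘ ∈-filter⁻ _))
                                                 cover fibre ⟩
    s ℕ.* length (without c (neighbours G v)) ≤⟨ ℕ.*-monoʳ-≤ s (length-without≤ (∈-neighbours⁺ v~c)) ⟩
    s ℕ.* pred (degree G v)                 ∎
    where
    open ℕ.≤-Reasoning
    R? = λ x y → (x ≟ y) ⊎-dec (x ~? y)

    cover : ∀ {x} → x ∈ without c (neighbours G w) →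
      ∃[ y ] (y ∈ without c (neighbours G v) × (x ≡ y ⊎ x ~ y))
    cover {x} x∈ with x∈Nw , x≢c ← ∈-filter⁻ (λ x → ¬? (x ≟ c)) x∈
      with w~x ← ∈-neighbours⁻ x∈Nw with v ~? x
    -- A common neighbour of `v` and `w` covers itself; this is why the covering relation includes
    -- equality.
    ... | yes v~x = x , ∈-filter⁺ _ (∈-neighbours⁺ v~x) x≢c , inj₁ refl
    ... | no  v≁x with y , v~y , x~y ← common-neighbour diam (λ { refl → v≁w (~-sym w~x) }) v≁x =
      -- `y` is not `c`, since `w`, `x`, `c` would then form a triangle.
      y , ∈-filter⁺ _ (∈-neighbours⁺ v~y) (λ { refl → no-triangle tri w~x x~y w~c }) , inj₂ x~y

    fibre : ∀ {y} → y ∈ without c (neighbours G v) → ∀ {zs} → Unique zs →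
      All (λ x → w ~ x × (x ≡ y ⊎ x ~ y)) zs → length zs ℕ.≤ s
    fibre {y} y∈ uniq all with v~y ← ∈-neighbours⁻ (proj₁ (∈-filter⁻ _ y∈)) with w ~? y
    -- Triangle-freeness leaves `y` as the only possible entry, and `s ≥ 1` absorbs it.
    ... | yes w~y = ℕ.≤-trans (all≡⇒length≤1 uniq (All.map equal all)) s≥1
      where
      equal : ∀ {x} → w ~ x × (x ≡ y ⊎ x ~ y) → x ≡ y
      equal (_   , inj₁ x≡y) = x≡y
      equal (w~x , inj₂ x~y) = ⊥-elim (no-triangle tri w~x x~y w~y)
    -- Now `x ≡ y` is impossible, so all entries are common neighbours of `w` and `y`.
    ... | no  w≁y = common-neighbours≤ free (λ { refl → v≁w v~y }) uniq (All.map common all)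
      where
      common : ∀ {x} → w ~ x × (x ≡ y ⊎ x ~ y) → w ~ x × y ~ x
      common (w~x , inj₁ refl) = contradiction w~x w≁y
      common (w~x , inj₂ x~y)  = w~x , ~-sym x~y

-- Two adjacent vertices other than `w` would form a triangle with it, so they are all leaves. The
-- vertex `v` guarantees at least one leaf.
dominating⇒star : (G : Graph (Fin n)) → TriangleFree G → (w v : Fin n) → w ≢ v →
  (∀ x → w ≢ x → Adj G w x) → IsStar G
dominating⇒star {suc m} G tri w v w≢v dominates = m , m≥1 , mk↔ₛ′ to from to-from from-to , edges
  where
  open Graph G using (_~_; irrefl) renaming (sym to ~-sym)

  m≥1 : m ≥ 1
  m≥1 = inhabited (punchOut w≢v)
    where
    inhabited : ∀ {k} → Fin k → k ≥ 1
    inhabited zero    = s≤s z≤n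
    inhabited (suc _) = s≤s z≤n

  to : Fin (suc m) → Fin 1 ⊎ Fin m
  to x with w ≟ x
  ... | yes _   = inj₁ zero
  ... | no  w≢x = inj₂ (punchOut w≢x)

  from : Fin 1 ⊎ Fin m → Fin (suc m)
  from (inj₁ _) = w
  from (inj₂ j) = punchIn w j

  to-from : ∀ p → to (from p) ≡ p
  to-from (inj₁ zero) with w ≟ w
  ... | yes _   = refl
  ... | no  w≢w = contradiction refl w≢w
  to-from (inj₂ j) with w ≟ punchIn w j
  ... | yes eq  = contradiction (sym eq) (punchInᵢ≢i w j)
  ... | no  _   = cong inj₂ (trans (punchOut-cong w refl) (punchOut-punchIn w))

  from-to : ∀ x → from (to x) ≡ x
  from-to x with w ≟ x
  ... | yes w≡x = w≡x
  ... | no  w≢x = punchIn-punchOut w≢x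

  edges : ∀ x y → x ~ y ⇔ AcrossParts 1 m (to x) (to y)
  edges x y with w ≟ x | w ≟ y
  ... | yes refl | yes refl = mk⇔ (irrefl refl) λ ()
  ... | yes refl | no  w≢y  = mk⇔ _ λ _ → dominates y w≢y
  ... | no  w≢x  | yes refl = mk⇔ _ λ _ → ~-sym (dominates x w≢x)
  ... | no  w≢x  | no  w≢y  =
    mk⇔ (λ x~y → no-triangle G tri (dominates x w≢x) x~y (dominates y w≢y)) λ ()

-- Degrees of arbitrary pairs of vertices

module _ {n : ℕ} (G : Graph (Fin n))
  (tri : TriangleFree G) (free : (CompleteBipartite 2 (suc s) -Free) G)
  (diam : HasDiameter G 2) (¬star : ¬ IsStar G) (s≥1 : s ≥ 1) where

  open Graph G using (_~_; _~?_) renaming (sym to ~-sym)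

  private
    m≤s*m : ∀ m → m ℕ.≤ s ℕ.* m
    m≤s*m m = subst (ℕ._≤ s ℕ.* m) (ℕ.*-identityˡ m) (ℕ.*-monoˡ-≤ m s≥1)

  -- If `w` were the only neighbour of `v`, any vertex not adjacent to `v` would have to share `w`
  -- with it, so `w` would dominate the graph.
  second-neighbour : ∀ {v w} → v ~ w → ∃[ a ] (v ~ a × a ≢ w)
  second-neighbour {v} {w} v~w with any? (λ a → (v ~? a) ×-dec ¬? (a ≟ w))
  ... | yes found = found
  ... | no  none  = contradiction
    (dominating⇒star G tri w v (~⇒≢ G (~-sym v~w)) dominates) ¬star
    where
    only-w : ∀ {x} → v ~ x → x ≡ w
    only-w {x} v~x with x ≟ w
    ... | yes x≡w = x≡w
    ... | no  x≢w = contradiction (x , v~x , x≢w) none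
    dominates : ∀ x → w ≢ x → w ~ x
    dominates x w≢x with v ≟ x
    ... | yes refl = ~-sym v~w
    ... | no  v≢x with common-neighbour G diam v≢x (w≢x ∘ sym ∘ only-w)
    ...   | c , v~c , x~c with refl ← only-w v~c = ~-sym x~c

  pred-degree-adjacent : ∀ {v w} → v ~ w → pred (degree G w) ℕ.≤ s ℕ.* (s ℕ.* pred (degree G v))
  pred-degree-adjacent {v} {w} v~w
    with a , v~a , a≢w ← second-neighbour v~w
    with any? (λ b → (w ~? b) ×-dec ¬? (a ~? b))
  ... | no none = begin
    pred (degree G w)                 ≤⟨ ℕ.pred[n]≤n ⟩
    degree G w                        ≤⟨ common-neighbours≤ G free (≢-sym a≢w)
                                           (neighbours-unique G w) (All.tabulate common) ⟩
    s                                 ≤⟨ m≤s*m s ⟩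
    s ℕ.* s                           ≡⟨ cong (s ℕ.*_) (ℕ.*-identityʳ s) ⟨
    s ℕ.* (s ℕ.* 1)                   ≤⟨ ℕ.*-monoʳ-≤ s (ℕ.*-monoʳ-≤ s degree≥2) ⟩
    s ℕ.* (s ℕ.* pred (degree G v))   ∎
    where
    open ℕ.≤-Reasoning
    common : ∀ {b} → b ∈ neighbours G w → w ~ b × a ~ b
    common {b} b∈ with a ~? b
    ... | yes a~b = ∈-neighbours⁻ G b∈ , a~b
    ... | no  a≁b = contradiction (b , ∈-neighbours⁻ G b∈ , a≁b) none
    -- `a` survives the removal of `w` from the neighbours of `v`.
    degree≥2 : 1 ℕ.≤ pred (degree G v)
    degree≥2 = ℕ.≤-trans
      (filter-some _ (Any.map (λ { refl → a≢w }) (∈-neighbours⁺ G v~a)))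
      (length-without≤ (∈-neighbours⁺ G v~w))
  ... | yes (b , w~b , a≁b)
    with z , a~z , b~z ← common-neighbour G diam
           (λ { refl → no-triangle G tri v~a (~-sym w~b) v~w }) a≁b = begin
    pred (degree G w)                 ≤⟨ pred-degree-nonadjacent G tri free diam s≥1 z≢w z≁w ⟩
    s ℕ.* pred (degree G z)           ≤⟨ ℕ.*-monoʳ-≤ s
                                           (pred-degree-nonadjacent G tri free diam s≥1 v≢z v≁z) ⟩
    s ℕ.* (s ℕ.* pred (degree G v))   ∎
    where
    open ℕ.≤-Reasoning
    -- The excluded triangles are `v`, `a`, `z` and, below, `w`, `b`, `z`. The inequalities follow
    -- because `v ~ w` while `z` is adjacent to neither.
    v≁z : ¬ v ~ z
    v≁z v~z = no-triangle G tri v~a a~z v~z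
    z≁w : ¬ z ~ w
    z≁w z~w = no-triangle G tri w~b b~z (~-sym z~w)
    v≢z : v ≢ z
    v≢z refl = z≁w v~w
    z≢w : z ≢ w
    z≢w refl = v≁z v~w

  pred-degree≤ : ∀ v w → pred (degree G w) ℕ.≤ s ℕ.* (s ℕ.* pred (degree G v))
  pred-degree≤ v w with v ~? w | v ≟ w
  ... | yes v~w | _        = pred-degree-adjacent v~w
  ... | no  _   | yes refl = ℕ.≤-trans (m≤s*m _) (m≤s*m _)
  ... | no  v≁w | no  v≢w  =
    ℕ.≤-trans (pred-degree-nonadjacent G tri free diam s≥1 v≢w v≁w) (m≤s*m _)

-- Extremal degrees and the final bound

degree≤n : (G : Graph (Fin n)) → ∀ v → degree G v ℕ.≤ n
degree≤n {n} G v =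
  ℕ.≤-trans (length-filter _ (allFin n)) (ℕ.≤-reflexive (length-tabulate id))

-- If the minimum is the default value `n`, then `u` attains it, since `degree G u` lies between
-- `δ G` and `n`.
δ-attained : (G : Graph (Fin n)) → Fin n → ∃[ v ] degree G v ≡ δ G
δ-attained {n} G u with argmin-sel id n (degrees G)
... | inj₁ δ≡n = u , ℕ.≤-antisym (subst (degree G u ℕ.≤_) (sym δ≡n) (degree≤n G u))
                       (All.lookup (min≤xs n (degrees G)) (∈-map⁺ (degree G) (∈-allFin u)))
... | inj₂ δ∈ with v , _ , δ≡ ← ∈-map⁻ (degree G) δ∈ = v , sym δ≡

Δ≤ : (G : Graph (Fin n)) → ∀ {b} → (∀ w → degree G w ℕ.≤ b) → Δ G ℕ.≤ b
Δ≤ {n} G bound = max≤v⁺ z≤n (All.map⁺ (All.tabulate {xs = allFin n} λ {w} _ → bound w))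

-- With S = t - 1 and D = d - 1, the inner bracket is S D + 1, and the whole right side collapses to
-- S² D + 1. The hypothesis `d ≥ 1` makes `pred d` equal to the integer d - 1.
bound-expansion : ∀ s {d} → d ≥ 1 →
  + suc (s ℕ.* (s ℕ.* pred d)) ≡
  (+ suc s - + 1) * ((+ suc s - + 1) * + d - + suc s + + 2) - + suc s + + 2
bound-expansion s {suc d} _ = trans
  (cong (_+_ (+ 1)) (trans (ℤ.pos-* s (s ℕ.* d)) (cong (+ s *_) (ℤ.pos-* s d))))
  (identity (+ s) (+ d))
  where
  identity : ∀ S D → + 1 + S * (S * D) ≡
    (+ 1 + S - + 1) * ((+ 1 + S - + 1) * (+ 1 + D) - (+ 1 + S) + + 2) - (+ 1 + S) + + 2
  identity = solve-∀

theorem2 : (t : ℕ) → t ≥ 2 →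
    (n : ℕ) (G : Graph (Fin n)) →
    TriangleFree G → (CompleteBipartite 2 t -Free) G → HasDiameter G 2 → ¬ IsStar G →
    + Δ G ≤ (+ t - + 1) * ((+ t - + 1) * + δ G - + t + + 2) - + t + + 2
theorem2 (suc s) (s≤s s≥1) n G tri free diam@(_ , _ , u , _) ¬star
  -- `u`, an end of a pair at distance 2, shows that the graph has a vertex; `v` has minimum degree.
  with v , degree≡δ ← δ-attained G u
  with x , v~x ← has-neighbour G diam v =
  subst (+ Δ G ≤_) (bound-expansion s δ≥1) (+≤+ (Δ≤ G degree≤))
  where
  δ≥1 : δ G ≥ 1
  δ≥1 = subst (_≥ 1) degree≡δ (∈-length (∈-neighbours⁺ G v~x))
  degree≤ : ∀ w → degree G w ℕ.≤ suc (s ℕ.* (s ℕ.* pred (δ G)))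
  degree≤ w = subst (λ d → degree G w ℕ.≤ suc (s ℕ.* (s ℕ.* pred d))) degree≡δ
    (ℕ.≤-trans (ℕ.m≤n+m∸n _ 1) (s≤s (pred-degree≤ G tri free diam ¬star s≥1 v w)))
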